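{- Every algorithm that optimally solves the Metric Forest Completion (MFC) problem on instances with $n$ points has query complexity $\Omega(n^2)$. Furthermore, for any multiplicative factor $p \geq 1$ (not necessarily a constant), any algorithm that, given an instance of MFC on $n$ points, finds a set $M \subseteq \mathcal{I}$ that completes $\mathcal{P}$ and satisfies $w_\mathcal{X}(M) \leq p \cdot w_\mathcal{X}(M^*)$, where $M^*$ is an optimal completion set, requires $\Omega(n^2)$ distance queries.
   Context: Setting. $(\mathcal{X},d)$ is a finite metric space with $\mathcal{X} = \{x_1,\dots,x_n\}$. The complete graph $G_\mathcal{X}$ has node set $\mathcal{X}$, all pairs of points as edges, and edge weights $w_\mathcal{X}(x,y) = d(x,y)$. For a set $F$ of edges, $w_\mathcal{X}(F) = \sum_{e\in F} w_\mathcal{X}(e)$. Metric Forest Completion (MFC). An instance consists of $(\mathcal{X},d)$, a partition $\mathcal{P} = \{P_1,\dots,P_t\}$ of $\mathcal{X}$ into disjoint nonempty components, and, for each $i$, a spanning tree $T_i = (P_i, E_{T_i})$ of $P_i$ (an arbitrary tree on the node set $P_i$, not necessarily of minimum weight). Let $E_t = \bigcup_{i=1}^t E_{T_i}$. Writing $P(x)$ for the component containing $x$, the set of inter-component edges is $\mathcal{I} = \{(x,y) \in \mathcal{X}\times\mathcal{X} : P(x) \neq P(y)\}$ (edges are undirected). A set $M \subseteq \mathcal{I}$ completes $\mathcal{P}$ (is a completion set) if the graph $(\mathcal{X}, M \cup E_t)$ is connected. The MFC problem is to minimize $w_\mathcal{X}(M) + w_\mathcal{X}(E_t)$ over all $M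 \subseteq \mathcal{I}$ that complete $\mathcal{P}$; $M^*$ denotes an optimal completion set (a minimizer). Query model. The algorithm is given $\mathcal{X}$, $\mathcal{P}$ and the trees $T_i$, but the distance function $d$ is accessible only through (adaptive) distance queries: a query specifies a pair $x,y\in\mathcal{X}$ and returns $d(x,y)$. The only guarantee on $d$ is that it is a metric. Query complexity is the number of distance queries needed in the worst case over instances with $n$ points. -}

module Defs where

open import Algebra.Bundles using (CommutativeRing)
open import Data.Bool.Base using (Bool; false; T)
open import Data.Bool.Properties using (T?)
open import Data.Fin.Base using (Fin; _<_)
open import Data.Fin.Properties using (any?; _<?_)
open import Data.List.Base
  using (List; _∷_; _∷ʳ_; allFin; cartesianProduct; filter; foldr; length; map)
open import Data.List.Relation.Unary.Linked using (Linked)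
open import Data.List.Relation.Unary.Unique.Propositional using (Unique)
open import Data.Nat.Base as ℕ using (ℕ; zero; suc)
open import Data.Product.Base using (_×_; _,_; ∃-syntax; map₂; uncurry)
open import Function.Bundles using (mk⇔)
open import Function.Definitions using (StrictlySurjective)
import Function.Metric.Structures as Metric
open import Level using (0ℓ; _⊔_) renaming (suc to lsuc)
open import Relation.Binary.Construct.Closure.ReflexiveTransitive using (Star)
open import Relation.Binary.Construct.Union using (_∪_)
open import Relation.Binary.Core using (Rel)
open import Relation.Binary.PropositionalEquality.Core
  using (_≡_; _≢_; subst)
open import Relation.Binary.Structures using (IsTotalOrder)
open import Relation.Nullary.Decidable.Core using (does; _×-dec_)
open import Relation.Nullary.Decidable using (does-⇔; dec-false)
open import Relation.Nullary.Negation.Core using (¬_)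
open import Relation.Unary using (Pred)

-- Distances and approximation factors live in an arbitrary ordered field;
-- the real numbers are the intended instance.
record OrderedField c ℓ₁ ℓ₂ : Set (lsuc (c ⊔ ℓ₁ ⊔ ℓ₂)) where
  infix 4 _≤_
  field
    commutativeRing : CommutativeRing c ℓ₁
  open CommutativeRing commutativeRing public
  field
    _≤_          : Rel Carrier ℓ₂
    isTotalOrder : IsTotalOrder _≈_ _≤_
    +-monoˡ-≤    : ∀ z {x y} → x ≤ y → x + z ≤ y + z
    *-nonNeg     : ∀ {x y} → 0# ≤ x → 0# ≤ y → 0# ≤ x * y
    1≉0          : ¬ (1# ≈ 0#)
    inverse      : ∀ x → ¬ (x ≈ 0#) → ∃[ y ] (x * y ≈ 1#)

-- A set of undirected edges (no loops) on the node set Fin n, as an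
-- adjacency matrix.
record EdgeSet (n : ℕ) : Set where
  field
    adj    : Fin n → Fin n → Bool
    sym    : ∀ x y → adj x y ≡ adj y x
    irrefl : ∀ x → adj x x ≡ false

open EdgeSet public using (adj)

Adj : ∀ {n} → EdgeSet n → Rel (Fin n) 0ℓ
Adj E x y = T (adj E x y)

⋃ : ∀ {n t} → (Fin t → EdgeSet n) → EdgeSet n
⋃ E = record
  { adj    = λ x y → does (any? λ i → T? (adj (E i) x y))
  ; sym    = λ x y → does-⇔
      (mk⇔ (map₂ λ {i} → subst T (EdgeSet.sym (E i) x y))
           (map₂ λ {i} → subst T (EdgeSet.sym (E i) y x)))
      (any? λ i → T? (adj (E i) x y)) (any? λ i → T? (adj (E i) y x))
  ; irrefl = λ x → dec-false (any? λ i → T? (adj (E i) x x))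
      λ (i , p) → subst T (EdgeSet.irrefl (E i) x) p
  }

-- Every undirected edge {x, y} is listed exactly once, as the pair with x < y.
edges : ∀ {n} → EdgeSet n → List (Fin n × Fin n)
edges {n} E =
  filter (λ (x , y) → (x <? y) ×-dec T? (adj E x y))
         (cartesianProduct (allFin n) (allFin n))

Connected : ∀ {n} → Rel (Fin n) 0ℓ → Set
Connected _∼_ = ∀ x y → Star _∼_ x y

-- A cycle is a closed walk v, vs, v whose at least three nodes v, vs are
-- pairwise distinct.
Acyclic : ∀ {n} → EdgeSet n → Set
Acyclic E = ∀ v vs → 2 ℕ.≤ length vs → Unique (v ∷ vs) →
            ¬ Linked (Adj E) (v ∷ (vs ∷ʳ v))

record IsSpanningTree {n} (P : Pred (Fin n) 0ℓ) (E : EdgeSet n) : Set where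
  field
    inside    : ∀ {x y} → Adj E x y → P x × P y
    connected : ∀ {x y} → P x → P y → Star (Adj E) x y
    acyclic   : Acyclic E

-- The part of an MFC instance that is given to the algorithm for free.
-- The component P i consists of the points x with component x ≡ i.
record Forest (n : ℕ) : Set where
  field
    t          : ℕ
    component  : Fin n → Fin t
    nonempty   : StrictlySurjective _≡_ component
    tree       : Fin t → EdgeSet n
    isTree     : ∀ i → IsSpanningTree (λ x → component x ≡ i) (tree i)

  treeEdges : EdgeSet n
  treeEdges = ⋃ tree

  InterComponent : Rel (Fin n) 0ℓ
  InterComponent x y = component x ≢ component y

open Forest public using (treeEdges; InterComponent)

record Completes {n} (F : Forest n) (M : EdgeSet n) : Set where
  field
    inter     : ∀ {x y} → Adj M x y → InterComponent F x y
    connected : Connected (Adj M ∪ Adj (treeEdges F))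

module MFC {c ℓ₁ ℓ₂} (K : OrderedField c ℓ₁ ℓ₂) where
  open OrderedField K public using (Carrier; _≈_; _≤_; _+_; _*_; 0#; 1#)

  Distance : ℕ → Set c
  Distance n = Fin n → Fin n → Carrier

  IsMetric : ∀ {n} → Distance n → Set (c ⊔ ℓ₁ ⊔ ℓ₂)
  IsMetric = Metric.IsGeneralMetric _≡_ _≈_ _≤_ 0# _+_

  weight : ∀ {n} → Distance n → EdgeSet n → Carrier
  weight d E = foldr _+_ 0# (map (uncurry d) (edges E))

  record IsOptimalCompletion {n} (d : Distance n) (F : Forest n) (M : EdgeSet n)
         : Set ℓ₂ where
    field
      completes : Completes F M
      minimal   : ∀ M′ → Completes F M′ →
                  weight d M  + weight d (treeEdges F) ≤
                  weight d M′ + weight d (treeEdges F)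

  record IsApproxCompletion {n} (p : Carrier) (d : Distance n) (F : Forest n)
         (M : EdgeSet n) : Set ℓ₂ where
    field
      completes : Completes F M
      approx    : ∀ M* → IsOptimalCompletion d F M* → weight d M ≤ p * weight d M*

  -- Adaptive strategies as well-founded decision trees: the answer to each
  -- query determines how to continue, and every run asks finitely many queries.
  data Strategy (n : ℕ) (A : Set) : Set c where
    return : A → Strategy n A
    query  : (x y : Fin n) → (Carrier → Strategy n A) → Strategy n A

  run : ∀ {n A} → Distance n → Strategy n A → A
  run d (return a)    = a
  run d (query x y k) = run d (k (d x y))

  queries : ∀ {n A} → Distance n → Strategy n A → ℕ
  queries d (return a)    = zero
  queries d (query x y k) = suc (queries d (k (d x y)))

  Algorithm : ℕ → Set c
  Algorithm n = Forest n → Strategy n (EdgeSet n)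

  Solves : ∀ {n} → Algorithm n → Set (c ⊔ ℓ₁ ⊔ ℓ₂)
  Solves A = ∀ d F → IsMetric d → IsOptimalCompletion d F (run d (A F))

  Approximates : ∀ {n} → Carrier → Algorithm n → Set (c ⊔ ℓ₁ ⊔ ℓ₂)
  Approximates p A = ∀ d F → IsMetric d → IsApproxCompletion p d F (run d (A F))

  -- The worst-case number of queries of A is at least n² / C.  The maximum
  -- over all instances need not exist, so it is bounded via a single instance.
  WorstCase≥n²/ : ∀ {n} → ℕ → Algorithm n → Set (c ⊔ ℓ₁ ⊔ ℓ₂)
  WorstCase≥n²/ {n} C A =
    ∃[ d ] ∃[ F ] (IsMetric d × n ℕ.^ 2 ℕ.≤ C ℕ.* queries d (A F))

{-# OPTIONS --safe #-}
-- Let F consist of two stars on about n/2 points each, and compare the uniform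
-- metric with the metrics in which one inter-component pair {a, b} has distance
-- ϵ < 1/p instead of 1.  In the latter, {ab} is the only completion set of
-- weight at most p ϵ.  If an algorithm does not query {a, b} in the uniform
-- metric then it returns the same set in both metrics, so that set is {ab}; this
-- happens for at most one pair {a, b}, so about n²/4 pairs are queried.
module Submission where

open import Defs
import Algebra.Properties.Ring as RingProperties
open import Data.Bool.Base using (true; false; T; if_then_else_)
open import Data.Bool.Properties using (T?)
open import Data.Fin.Base as Fin using (Fin; zero; suc; _↑ˡ_; _↑ʳ_; splitAt; remQuot; combine)
open import Data.Fin.Properties as Fin using (any?; _<?_)
open import Data.List.Base
  using (List; []; _∷_; _∷ʳ_; _++_; allFin; cartesianProduct; foldr; length; lookup; map)
import Data.List.Membership.DecPropositional as DecMembership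
open import Data.List.Membership.Propositional using (_∈_)
open import Data.List.Membership.Propositional.Properties
  using (∈-++⁺ˡ; ∈-++⁺ʳ; ∈-map⁺; ∈-filter⁺; ∈-filter⁻; ∈-cartesianProduct⁺; ∈-allFin)
open import Data.List.Properties using (length-++; length-map)
open import Data.List.Relation.Unary.All using (All; _∷_)
open import Data.List.Relation.Unary.AllPairs using (_∷_)
open import Data.List.Relation.Unary.Any using (here; there; index)
open import Data.List.Relation.Unary.Any.Properties using (lookup-index)
open import Data.List.Relation.Unary.Linked using (Linked; _∷_)
open import Data.List.Relation.Unary.Unique.Propositional using (Unique)
import Data.List.Relation.Unary.Unique.Propositional.Properties as Unique
open import Data.Nat.Base as ℕ using (ℕ; zero; suc)
import Data.Nat.Properties as ℕ
open import Data.Nat.Solver using (module +-*-Solver)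
open import Data.Product.Base using (_×_; _,_; ∃-syntax; proj₁; proj₂; uncurry; swap)
import Data.Product.Properties as Product
open import Data.Sum.Base as Sum using (_⊎_; inj₁; inj₂; [_,_]′)
open import Data.Unit.Base using (tt)
open import Function.Base using (_∘_; const; case_of_)
open import Function.Bundles using (mk⇔)
import Function.Metric.Structures as Metric
open import Level using (0ℓ)
open import Relation.Binary.Bundles using (Poset)
open import Relation.Binary.Construct.Closure.ReflexiveTransitive as Star using (Star; ε; _◅_; _◅◅_)
open import Relation.Binary.Construct.Union using (_∪_)
open import Relation.Binary.Core using (Rel)
open import Relation.Binary.Definitions using (Decidable; Symmetric; Irreflexive; tri<; tri≈; tri>)
open import Relation.Binary.PropositionalEquality as ≡
  using (_≡_; _≢_; refl; sym; trans; cong; cong₂; subst; ≢-sym)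
import Relation.Binary.Reasoning.PartialOrder as PosetReasoning
open import Relation.Binary.Structures using (IsTotalOrder)
open import Relation.Nullary.Decidable
  using (Dec; yes; no; does; ¬?; _×-dec_; _⊎-dec_; dec-true; dec-false; does-⇔; decidable-stable)
open import Relation.Nullary.Negation using (¬_; contradiction)
open import Relation.Unary as Unary using (Pred)

private variable
  n : ℕ

-- Edge sets from decidable relations

does⁺ : ∀ {a} {A : Set a} (a? : Dec A) → A → T (does a?)
does⁺ a? a = subst T (sym (dec-true a? a)) tt

does⁻ : ∀ {a} {A : Set a} (a? : Dec A) → T (does a?) → A
does⁻ (yes a) _ = a

fromDecidable : {R : Rel (Fin n) 0ℓ} →
  Decidable R → Symmetric R → Irreflexive _≡_ R → EdgeSet n
fromDecidable R? R-sym R-irrefl = record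
  { adj    = λ x y → does (R? x y)
  ; sym    = λ x y → does-⇔ (mk⇔ R-sym R-sym) (R? x y) (R? y x)
  ; irrefl = λ x → dec-false (R? x x) (R-irrefl refl)
  }

Adj-sym : (E : EdgeSet n) → Symmetric (Adj E)
Adj-sym E {x} {y} = subst T (EdgeSet.sym E x y)

Adj-irrefl : (E : EdgeSet n) → Irreflexive _≡_ (Adj E)
Adj-irrefl E {x} refl = subst T (EdgeSet.irrefl E x)

-- Stars

Spoke : Pred (Fin n) 0ℓ → Fin n → Rel (Fin n) 0ℓ
Spoke P c x y = (P x × P y) × x ≢ y × (x ≡ c ⊎ y ≡ c)

spoke? : {P : Pred (Fin n) 0ℓ} → Unary.Decidable P → ∀ c → Decidable (Spoke P c)
spoke? P? c x y =
  (P? x ×-dec P? y) ×-dec ¬? (x Fin.≟ y) ×-dec (x Fin.≟ c ⊎-dec y Fin.≟ c)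

star : {P : Pred (Fin n) 0ℓ} → Unary.Decidable P → Fin n → EdgeSet n
star P? c = fromDecidable (spoke? P? c)
  (λ (p , x≢y , q) → swap p , ≢-sym x≢y , Sum.swap q)
  (λ x≡y (_ , x≢y , _) → x≢y x≡y)

star-isSpanningTree : {P : Pred (Fin n) 0ℓ} (P? : Unary.Decidable P) {c : Fin n} →
  P c → IsSpanningTree P (star P? c)
star-isSpanningTree {n} {P} P? {c} Pc = record
  { inside    = proj₁ ∘ spoke
  ; connected = λ Px Py → Star.reverse (λ {x} → Adj-sym (star P? c) {x}) (fromCentre Px) ◅◅ fromCentre Py
  ; acyclic   = acyclic
  }
  where
  spoke : ∀ {x y} → Adj (star P? c) x y → Spoke P c x y
  spoke {x} {y} = does⁻ (spoke? P? c x y)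

  end : ∀ {x y} → Adj (star P? c) x y → x ≡ c ⊎ y ≡ c
  end = proj₂ ∘ proj₂ ∘ spoke

  fromCentre : ∀ {x} → P x → Star (Adj (star P? c)) c x
  fromCentre {x} Px with c Fin.≟ x
  ... | yes refl = ε
  ... | no c≢x   = does⁺ (spoke? P? c c x) ((Pc , Px) , c≢x , inj₁ refl) ◅ ε

  -- Every edge contains c, so among the first three edges of a cycle two
  -- non-adjacent nodes would have to be c.
  acyclic : Acyclic (star P? c)
  acyclic v (_ ∷ [])     (ℕ.s≤s ())
  acyclic v (w ∷ u ∷ vs) _ ((v≢w ∷ v≢u ∷ _) ∷ (w≢u ∷ w≢vs) ∷ _) (vw ∷ wu ∷ us)
    with end vw | end wu
  ... | inj₁ refl | inj₁ w≡c = v≢w (sym w≡c)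
  ... | inj₁ refl | inj₂ u≡c = v≢u (sym u≡c)
  -- With the centre at `w` the first two edges are consistent, so the third one, from `u` to the
  -- next node or back to `v`, has to be refuted.
  ... | inj₂ refl | _        = third vs w≢vs us
    where
    third : ∀ vs → All (c ≢_) vs → ¬ Linked (Adj (star P? c)) (u ∷ (vs ∷ʳ v))
    third []      _         (uv ∷ _) = [ ≢-sym w≢u , v≢w ]′ (end uv)
    third (_ ∷ _) (c≢z ∷ _) (uz ∷ _) = [ ≢-sym w≢u , ≢-sym c≢z ]′ (end uz)

starForest : ∀ {t} (component : Fin n → Fin t) (centre : Fin t → Fin n) →
  (∀ i → component (centre i) ≡ i) → Forest n
starForest component centre component-centre = record
  { component = component
  ; nonempty  = λ i → centre i , component-centre i
  ; tree      = λ i → star (λ x → component x Fin.≟ i) (centre i)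
  ; isTree    = λ i → star-isSpanningTree (λ x → component x Fin.≟ i) (component-centre i)
  }

-- Completion sets

module _ (F : Forest n) where
  open Forest F using (component; tree; isTree)

  treeEdges⁺ : ∀ i {x y} → Adj (tree i) x y → Adj (treeEdges F) x y
  treeEdges⁺ i {x} {y} xy = does⁺ (any? _) (i , xy)

  treeEdges⁻ : ∀ {x y} → Adj (treeEdges F) x y → ∃[ i ] Adj (tree i) x y
  treeEdges⁻ = does⁻ (any? _)

  treeEdges⇒component≡ : ∀ {x y} → Adj (treeEdges F) x y → component x ≡ component y
  treeEdges⇒component≡ xy with i , xyᵢ ← treeEdges⁻ xy =
    let x∈i , y∈i = IsSpanningTree.inside (isTree i) xyᵢ in trans x∈i (sym y∈i)

  component≡⇒Star : ∀ {x y} → component x ≡ component y → Star (Adj (treeEdges F)) x y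
  component≡⇒Star {x} x∼y = Star.map (treeEdges⁺ (component x))
    (IsSpanningTree.connected (isTree (component x)) refl (sym x∼y))

  -- Tree edges stay inside a component, so a walk that ends in another component must use an edge
  -- of `M`; the recursion stops at the first one.
  crossingEdge : ∀ M {x y} → Star (Adj M ∪ Adj (treeEdges F)) x y →
    InterComponent F x y → ∃[ u ] ∃[ v ] Adj M u v
  crossingEdge M ε             x≁y = contradiction refl x≁y
  crossingEdge M (inj₁ xz ◅ _) x≁y = _ , _ , xz
  crossingEdge M (inj₂ xz ◅ z⇝y) x≁y =
    crossingEdge M z⇝y (x≁y ∘ trans (treeEdges⇒component≡ xz))

-- Completion by a single edge

Joins : Fin n → Fin n → Rel (Fin n) 0ℓ
Joins a b x y = (x ≡ a × y ≡ b) ⊎ (x ≡ b × y ≡ a)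

joins? : (a b : Fin n) → Decidable (Joins a b)
joins? a b x y = (x Fin.≟ a ×-dec y Fin.≟ b) ⊎-dec (x Fin.≟ b ×-dec y Fin.≟ a)

singleEdge : {a b : Fin n} → a ≢ b → EdgeSet n
singleEdge {a = a} {b} a≢b = fromDecidable (joins? a b)
  [ (λ (p , q) → inj₂ (q , p)) , (λ (p , q) → inj₁ (q , p)) ]′
  λ { refl (inj₁ (p , q)) → a≢b (trans (sym p) q)
    ; refl (inj₂ (p , q)) → a≢b (trans (sym q) p) }

noEdges : EdgeSet n
noEdges = record { adj = λ _ _ → false ; sym = λ _ _ → refl ; irrefl = λ _ → refl }

module _ {a b : Fin n} (a≢b : a ≢ b) where

  singleEdge⁺ : ∀ {x y} → Joins a b x y → Adj (singleEdge a≢b) x y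
  singleEdge⁺ {x} {y} = does⁺ (joins? a b x y)

  singleEdge⁻ : ∀ {x y} → Adj (singleEdge a≢b) x y → Joins a b x y
  singleEdge⁻ {x} {y} = does⁻ (joins? a b x y)

-- Each component is connected by its own tree, and `cover` leaves no component besides those of `a`
-- and `b`, so one bridge suffices.
singleEdge-completes : (F : Forest n) → let open Forest F using (component) in
  ∀ {a b} (a≢b : a ≢ b) → component a ≢ component b →
  (∀ x → component x ≡ component a ⊎ component x ≡ component b) →
  Completes F (singleEdge a≢b)
singleEdge-completes {n} F {a} {b} a≢b a≁b cover = record
  { inter     = λ {x} {y} xy → case singleEdge⁻ a≢b {x} {y} xy of λ where
      (inj₁ (refl , refl)) → a≁b
      (inj₂ (refl , refl)) → ≢-sym a≁b
  ; connected = connected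
  }
  where
  open Forest F using (component)

  Path : Rel (Fin n) 0ℓ
  Path = Star (Adj (singleEdge a≢b) ∪ Adj (treeEdges F))

  inTree : ∀ {x y} → component x ≡ component y → Path x y
  inTree = Star.map inj₂ ∘ component≡⇒Star F

  bridge : ∀ {x y} → Joins a b x y → Path x y
  bridge ab = inj₁ (singleEdge⁺ a≢b ab) ◅ ε

  connected : ∀ x y → Path x y
  connected x y with cover x | cover y
  ... | inj₁ x∼a | inj₁ y∼a = inTree (trans x∼a (sym y∼a))
  ... | inj₁ x∼a | inj₂ y∼b =
    inTree x∼a ◅◅ bridge (inj₁ (refl , refl)) ◅◅ inTree (sym y∼b)
  ... | inj₂ x∼b | inj₁ y∼a =
    inTree x∼b ◅◅ bridge (inj₂ (refl , refl)) ◅◅ inTree (sym y∼a)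
  ... | inj₂ x∼b | inj₂ y∼b = inTree (trans x∼b (sym y∼b))

-- Edge lists and matchings

edges-unique : (E : EdgeSet n) → Unique (edges E)
edges-unique E =
  Unique.filter⁺ _ (Unique.cartesianProduct⁺ (Unique.allFin⁺ _) (Unique.allFin⁺ _))

∈-edges⁺ : (E : EdgeSet n) → ∀ {x y} → x Fin.< y → Adj E x y → (x , y) ∈ edges E
∈-edges⁺ E {x} {y} x<y xy =
  ∈-filter⁺ _ (∈-cartesianProduct⁺ (∈-allFin x) (∈-allFin y)) (x<y , xy)

∈-edges⁻ : (E : EdgeSet n) → ∀ {x y} → (x , y) ∈ edges E → x Fin.< y × Adj E x y
∈-edges⁻ {n} E {x} {y} e =
  proj₂ (∈-filter⁻ (λ (x , y) → (x <? y) ×-dec _) {xs = cartesianProduct (allFin n) (allFin n)} e)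

-- Only increasing pairs are listed, which rules out having both orientations of the edge.
singleEdge-edges : {a b : Fin n} (a≢b : a ≢ b) → ∀ {e f} →
  e ∈ edges (singleEdge a≢b) → f ∈ edges (singleEdge a≢b) → e ≡ f
singleEdge-edges a≢b {x , y} {u , v} e∈ f∈
  with e< , e ← ∈-edges⁻ (singleEdge a≢b) e∈ | f< , f ← ∈-edges⁻ (singleEdge a≢b) f∈
  with singleEdge⁻ a≢b {x} {y} e | singleEdge⁻ a≢b {u} {v} f
... | inj₁ (refl , refl) | inj₁ (refl , refl) = refl
... | inj₁ (refl , refl) | inj₂ (refl , refl) = contradiction f< (Fin.<-asym e<)
... | inj₂ (refl , refl) | inj₁ (refl , refl) = contradiction f< (Fin.<-asym e<)
... | inj₂ (refl , refl) | inj₂ (refl , refl) = refl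

-- As adjacency is symmetric, `x` and `z` are both neighbours of `y`: no node has two neighbours.
-- This keeps two short steps in a row from shortcutting a long one.
Matching : EdgeSet n → Set
Matching E = ∀ x y z → Adj E x y → Adj E y z → x ≡ z

singleEdge-matching : {a b : Fin n} (a≢b : a ≢ b) → Matching (singleEdge a≢b)
singleEdge-matching a≢b x y z xy yz
  with singleEdge⁻ a≢b {x} {y} xy | singleEdge⁻ a≢b {y} {z} yz
... | inj₁ (_ , y≡b)  | inj₁ (y≡a , _)  = contradiction (trans (sym y≡a) y≡b) a≢b
... | inj₁ (x≡a , _)  | inj₂ (_ , z≡a)  = trans x≡a (sym z≡a)
... | inj₂ (x≡b , _)  | inj₁ (_ , z≡b)  = trans x≡b (sym z≡b)
... | inj₂ (_ , y≡a)  | inj₂ (y≡b , _)  = contradiction (trans (sym y≡a) y≡b) a≢b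

-- Ordered fields

module OrderedFieldProperties {c ℓ₁ ℓ₂} (K : OrderedField c ℓ₁ ℓ₂) where
  open OrderedField K hiding (refl; sym; trans; reflexive)
  open RingProperties ring
  open IsTotalOrder isTotalOrder public using (total; antisym; isPartialOrder)
    renaming (reflexive to ≤-reflexive; refl to ≤-refl; trans to ≤-trans)
  module ≈ = OrderedField K using (refl; sym; reflexive)

  poset : Poset c ℓ₁ ℓ₂
  poset = record { isPartialOrder = isPartialOrder }

  open PosetReasoning poset

  +-monoʳ-≤ : ∀ z {x y} → x ≤ y → z + x ≤ z + y
  +-monoʳ-≤ z {x} {y} x≤y = begin
    z + x ≈⟨ +-comm z x ⟩
    x + z ≤⟨ +-monoˡ-≤ z x≤y ⟩
    y + z ≈⟨ +-comm y z ⟩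
    z + y ∎

  x≤x+y : ∀ {x y} → 0# ≤ y → x ≤ x + y
  x≤x+y {x} {y} 0≤y = begin
    x      ≈⟨ +-identityʳ x ⟨
    x + 0# ≤⟨ +-monoʳ-≤ x 0≤y ⟩
    x + y  ∎

  x≤y+x : ∀ {x y} → 0# ≤ y → x ≤ y + x
  x≤y+x {x} {y} 0≤y = ≤-trans (x≤x+y 0≤y) (≤-reflexive (+-comm x y))

  +-nonNeg : ∀ {x y} → 0# ≤ x → 0# ≤ y → 0# ≤ x + y
  +-nonNeg 0≤x 0≤y = ≤-trans 0≤x (x≤x+y 0≤y)

  +-cancelʳ-≤ : ∀ z {x y} → x + z ≤ y + z → x ≤ y
  +-cancelʳ-≤ z {x} {y} x+z≤y+z = begin
    x         ≈⟨ //-rightDividesʳ z x ⟨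
    x + z - z ≤⟨ +-monoˡ-≤ (- z) x+z≤y+z ⟩
    y + z - z ≈⟨ //-rightDividesʳ z y ⟩
    y         ∎

  x≤y⇒0≤y-x : ∀ {x y} → x ≤ y → 0# ≤ y - x
  x≤y⇒0≤y-x {x} {y} x≤y = begin
    0#    ≈⟨ -‿inverseʳ x ⟨
    x - x ≤⟨ +-monoˡ-≤ (- x) x≤y ⟩
    y - x ∎

  *-monoˡ-≤ : ∀ {x y z} → 0# ≤ z → x ≤ y → z * x ≤ z * y
  *-monoˡ-≤ {x} {y} {z} 0≤z x≤y = begin
    z * x                 ≤⟨ x≤y+x (*-nonNeg 0≤z (x≤y⇒0≤y-x x≤y)) ⟩
    z * (y - x) + z * x   ≈⟨ distribˡ z (y - x) x ⟨
    z * (y - x + x)       ≈⟨ *-congˡ (//-rightDividesˡ x y) ⟩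
    z * y                 ∎

  -- If 1 were at most 0, then -1 would be nonnegative, and so would its square, which is 1.
  0≤1 : 0# ≤ 1#
  0≤1 with total 0# 1#
  ... | inj₁ 0≤1 = 0≤1
  ... | inj₂ 1≤0 = begin
    0#            ≤⟨ *-nonNeg 0≤-1 0≤-1 ⟩
    - 1# * - 1#   ≈⟨ -1*x≈-x (- 1#) ⟩
    - (- 1#)      ≈⟨ -‿involutive 1# ⟩
    1#            ∎
    where
    0≤-1 : 0# ≤ - 1#
    0≤-1 = ≤-trans (x≤y⇒0≤y-x 1≤0) (≤-reflexive (+-identityˡ (- 1#)))

  1≰0 : ¬ 1# ≤ 0#
  1≰0 1≤0 = 1≉0 (antisym 1≤0 0≤1)

  -- The witness is 1 / (1 + p).
  ∃-small : ∀ {p} → 0# ≤ p → ∃[ ϵ ] (0# ≤ ϵ × ¬ ϵ ≈ 0# × ϵ ≤ 1# × ¬ 1# ≤ p * ϵ)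
  ∃-small {p} 0≤p = ϵ , 0≤ϵ , ϵ≉0 , ϵ≤1 , 1≰pϵ
    where
    s≉0 : ¬ 1# + p ≈ 0#
    s≉0 s≈0 = 1≰0 (≤-trans (x≤x+y 0≤p) (≤-reflexive s≈0))

    ϵ : Carrier
    ϵ = proj₁ (inverse (1# + p) s≉0)

    sϵ≈1 : (1# + p) * ϵ ≈ 1#
    sϵ≈1 = proj₂ (inverse (1# + p) s≉0)

    -- This splits 1 into two summands: `ϵ ≤ 1` because `p * ϵ` is nonnegative, and `1 ≤ p * ϵ`
    -- fails because it would force `ϵ ≤ 0`.
    ϵ+pϵ≈1 : ϵ + p * ϵ ≈ 1#
    ϵ+pϵ≈1 = begin-equality
      ϵ + p * ϵ      ≈⟨ +-congʳ (*-identityˡ ϵ) ⟨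
      1# * ϵ + p * ϵ ≈⟨ distribʳ ϵ 1# p ⟨
      (1# + p) * ϵ   ≈⟨ sϵ≈1 ⟩
      1#             ∎

    ϵ≰0 : ¬ ϵ ≤ 0#
    ϵ≰0 ϵ≤0 = 1≰0 (begin
      1#            ≈⟨ sϵ≈1 ⟨
      (1# + p) * ϵ  ≤⟨ *-monoˡ-≤ (+-nonNeg 0≤1 0≤p) ϵ≤0 ⟩
      (1# + p) * 0# ≈⟨ zeroʳ (1# + p) ⟩
      0#            ∎)

    0≤ϵ : 0# ≤ ϵ
    0≤ϵ = [ (λ 0≤ϵ → 0≤ϵ) , (λ ϵ≤0 → contradiction ϵ≤0 ϵ≰0) ]′ (total 0# ϵ)

    ϵ≉0 : ¬ ϵ ≈ 0#
    ϵ≉0 = ϵ≰0 ∘ ≤-reflexive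

    ϵ≤1 : ϵ ≤ 1#
    ϵ≤1 = ≤-trans (x≤x+y (*-nonNeg 0≤p 0≤ϵ)) (≤-reflexive ϵ+pϵ≈1)

    1≰pϵ : ¬ 1# ≤ p * ϵ
    1≰pϵ 1≤pϵ = ϵ≰0 (+-cancelʳ-≤ (p * ϵ) (begin
      ϵ + p * ϵ  ≈⟨ ϵ+pϵ≈1 ⟩
      1#         ≤⟨ 1≤pϵ ⟩
      p * ϵ      ≈⟨ +-identityˡ (p * ϵ) ⟨
      0# + p * ϵ ∎))

  module _ {a} {A : Set a} (f : A → Carrier) where

    sum-nonNeg : (∀ x → 0# ≤ f x) → ∀ xs → 0# ≤ foldr _+_ 0# (map f xs)
    sum-nonNeg 0≤f []       = ≤-refl
    sum-nonNeg 0≤f (x ∷ xs) = +-nonNeg (0≤f x) (sum-nonNeg 0≤f xs)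

    ∈⇒≤sum : (∀ x → 0# ≤ f x) → ∀ {x xs} → x ∈ xs → f x ≤ foldr _+_ 0# (map f xs)
    ∈⇒≤sum 0≤f {xs = _ ∷ xs} (here refl) = x≤x+y (sum-nonNeg 0≤f xs)
    ∈⇒≤sum 0≤f {xs = y ∷ _}  (there x∈)  = ≤-trans (∈⇒≤sum 0≤f x∈) (x≤y+x (0≤f y))

    -- Two entries would be equal, against uniqueness, so there is at most one summand; `0 ≤ b`
    -- handles the empty list. For a single edge this avoids deciding which orientation is listed.
    sum-atMostOne-≤ : ∀ {xs b} → 0# ≤ b → Unique xs →
      (∀ {x y} → x ∈ xs → y ∈ xs → x ≡ y) → (∀ {x} → x ∈ xs → f x ≤ b) →
      foldr _+_ 0# (map f xs) ≤ b
    sum-atMostOne-≤ {[]}         0≤b _ _ _   = 0≤b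
    sum-atMostOne-≤ {x ∷ []}     0≤b _ _ f≤b =
      ≤-trans (≤-reflexive (+-identityʳ (f x))) (f≤b (here refl))
    sum-atMostOne-≤ {_ ∷ _ ∷ _} 0≤b ((x≢y ∷ _) ∷ _) x≡y _ =
      contradiction (x≡y (here refl) (there (here refl))) x≢y

-- Two-valued metrics and strategies

module _ {c ℓ₁ ℓ₂} (K : OrderedField c ℓ₁ ℓ₂) where
  open OrderedField K using (Carrier; _≈_; _≤_; _+_; _*_; 0#; 1#; 1≉0; +-monoˡ-≤; *-identityˡ)
  open MFC K hiding (Carrier; _≈_; _≤_; _+_; _*_; 0#; 1#)
  open OrderedFieldProperties K

  -- The weight is a sum of nonnegative terms, one of which belongs to this edge. That term may have
  -- the opposite orientation, which the symmetry of `d` repairs.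
  adj≤weight : {d : Distance n} → IsMetric d → (M : EdgeSet n) →
    ∀ {x y} → Adj M x y → d x y ≤ weight d M
  adj≤weight {d = d} d-metric M {x} {y} xy with Fin.<-cmp x y
  ... | tri< x<y _ _ = ∈⇒≤sum (uncurry d) (λ _ → nonNegative) (∈-edges⁺ M x<y xy)
    where open Metric.IsGeneralMetric d-metric using (nonNegative)
  ... | tri≈ _ x≡y _ = contradiction xy (Adj-irrefl M x≡y)
  ... | tri> _ _ y<x = ≤-trans (≤-reflexive (d-sym x y))
      (∈⇒≤sum (uncurry d) (λ _ → nonNegative) (∈-edges⁺ M y<x (Adj-sym M xy)))
    where open Metric.IsGeneralMetric d-metric using (nonNegative) renaming (sym to d-sym)

  -- One family contains the uniform metric and all planted ones, so the metric axioms are checked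
  -- once.
  dist : Carrier → EdgeSet n → Distance n
  dist ϵ E x y = if does (x Fin.≟ y) then 0# else if adj E x y then ϵ else 1#

  dist-sym : ∀ ϵ (E : EdgeSet n) x y → dist ϵ E x y ≡ dist ϵ E y x
  dist-sym ϵ E x y = cong₂ (λ b c → if b then 0# else if c then ϵ else 1#)
    (does-⇔ (mk⇔ sym sym) (x Fin.≟ y) (y Fin.≟ x)) (EdgeSet.sym E x y)

  dist-0 : ∀ ϵ (E : EdgeSet n) x → dist ϵ E x x ≡ 0#
  dist-0 ϵ E x rewrite dec-true (x Fin.≟ x) refl = refl

  dist-adj : ∀ ϵ (E : EdgeSet n) {x y} → Adj E x y → dist ϵ E x y ≡ ϵ
  dist-adj ϵ E {x} {y} xy with x Fin.≟ y | adj E x y in eq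
  ... | yes x≡y | _    = contradiction (subst T (sym eq) xy) (Adj-irrefl E x≡y)
  ... | no _    | true = refl

  dist-¬adj : ∀ ϵ (E : EdgeSet n) {x y} → x ≢ y → ¬ Adj E x y → dist ϵ E x y ≡ 1#
  dist-¬adj ϵ E {x} {y} x≢y ¬xy with x Fin.≟ y | adj E x y
  ... | yes x≡y | _     = contradiction x≡y x≢y
  ... | no _    | true  = contradiction tt ¬xy
  ... | no _    | false = refl

  module _ {ϵ} (0≤ϵ : 0# ≤ ϵ) (ϵ≉0 : ¬ ϵ ≈ 0#) (ϵ≤1 : ϵ ≤ 1#) (E : EdgeSet n) where

    private
      d : Distance n
      d = dist ϵ E

    dist-nonNeg : ∀ x y → 0# ≤ d x y
    dist-nonNeg x y with x Fin.≟ y | adj E x y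
    ... | yes _ | _     = ≤-refl
    ... | no _  | true  = 0≤ϵ
    ... | no _  | false = 0≤1

    dist≤1 : ∀ x y → d x y ≤ 1#
    dist≤1 x y with x Fin.≟ y | adj E x y
    ... | yes _ | _     = 0≤1
    ... | no _  | true  = ϵ≤1
    ... | no _  | false = ≤-refl

    ϵ≤dist : ∀ {x y} → x ≢ y → ϵ ≤ d x y
    ϵ≤dist {x} {y} x≢y with x Fin.≟ y | adj E x y
    ... | yes x≡y | _     = contradiction x≡y x≢y
    ... | no _    | true  = ≤-refl
    ... | no _    | false = ϵ≤1

    dist≈0⇒≡ : ∀ x y → d x y ≈ 0# → x ≡ y
    dist≈0⇒≡ x y d≈0 with x Fin.≟ y | adj E x y
    ... | yes x≡y | _     = x≡y
    ... | no _    | true  = contradiction d≈0 ϵ≉0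
    ... | no _    | false = contradiction d≈0 1≉0

    -- Of two adjacent steps between distinct points x, y, z at least one is not
    -- in the matching, and thus has length 1.
    dist-triangle : Matching E → ∀ x y z → d x z ≤ d x y + d y z
    dist-triangle matching x y z = case x Fin.≟ z of λ where
        (yes refl) → ≤-trans (≤-reflexive (≈.reflexive (dist-0 ϵ E x)))
                             (+-nonNeg (dist-nonNeg x y) (dist-nonNeg y x))
        (no x≢z) → case x Fin.≟ y of λ where
          (yes refl) → x≤y+x (dist-nonNeg x x)
          (no x≢y) → case y Fin.≟ z of λ where
            (yes refl) → x≤x+y (dist-nonNeg z z)
            (no y≢z) → case T? (adj E x y) of λ where
              (no ¬xy) → ≤-trans (1≤ x≢y ¬xy) (x≤x+y (dist-nonNeg y z))
              (yes xy) → ≤-trans (1≤ y≢z λ yz → x≢z (matching x y z xy yz))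
                                 (x≤y+x (dist-nonNeg x y))
      where
      -- No distance exceeds 1, so a single step of length 1 already bounds `d x z`.
      1≤ : ∀ {u v} → u ≢ v → ¬ Adj E u v → d x z ≤ d u v
      1≤ u≢v ¬uv = ≤-trans (dist≤1 x z) (≤-reflexive (≈.reflexive (sym (dist-¬adj ϵ E u≢v ¬uv))))

    dist-isMetric : Matching E → IsMetric d
    dist-isMetric matching = record
      { isSemiMetric = record
        { isQuasiSemiMetric = record
          { isPreMetric = record
            { isProtoMetric = record
              { isPartialOrder  = isPartialOrder
              ; ≈-isEquivalence = ≡.isEquivalence
              ; cong            = λ { refl refl → ≈.refl }
              ; nonNegative     = λ {x} {y} → dist-nonNeg x y
              }
            ; ≈⇒0 = λ { {x} refl → ≈.reflexive (dist-0 ϵ E x) }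
            }
          ; 0⇒≈ = λ {x} {y} → dist≈0⇒≡ x y
          }
        ; sym = λ x y → ≈.reflexive (dist-sym ϵ E x y)
        }
      ; triangle = dist-triangle matching
      }

  module _ {A : Set} where

    -- Strategies are adaptive, so the list of queries exists only relative to the answers of a
    -- given `d`.
    asked : Distance n → Strategy n A → List (Fin n × Fin n)
    asked d (return _)    = []
    asked d (query x y k) = (x , y) ∷ asked d (k (d x y))

    length-asked : (d : Distance n) (S : Strategy n A) → length (asked d S) ≡ queries d S
    length-asked d (return _)    = refl
    length-asked d (query x y k) = cong suc (length-asked d (k (d x y)))

    -- Equal answers lead to the same branch of the decision tree, so it is enough to compare the
    -- answers along the run under `d`. Agreement is up to `≡`, since a continuation need not
    -- respect `≈`.
    run-cong : {d d′ : Distance n} (S : Strategy n A) →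
      (∀ {x y} → (x , y) ∈ asked d S → d x y ≡ d′ x y) → run d S ≡ run d′ S
    run-cong (return _) _ = refl
    run-cong {d = d} {d′} (query x y k) d≡d′ = trans
      (run-cong (k (d x y)) (d≡d′ ∘ there))
      (cong (run d′ ∘ k) (d≡d′ (here refl)))

  -- The weight of the trees occurs on both sides of optimality and cancels. This reduces the exact
  -- problem to the approximate one with factor 1.
  Solves⇒Approximates : {A : Algorithm n} → Solves A → Approximates 1# A
  Solves⇒Approximates solves d F d-metric = record
    { completes = completes
    ; approx    = λ M* M*-optimal → ≤-trans
        (+-cancelʳ-≤ _ (minimal M* (IsOptimalCompletion.completes M*-optimal)))
        (≤-reflexive (≈.sym (*-identityˡ _)))
    }
    where open IsOptimalCompletion (solves d F d-metric)

  -- Metrics with one planted short pair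

  module _ {ϵ} (0≤ϵ : 0# ≤ ϵ) (ϵ≉0 : ¬ ϵ ≈ 0#) (ϵ≤1 : ϵ ≤ 1#) {a b : Fin n} (a≢b : a ≢ b) where

    private
      E : EdgeSet n
      E = singleEdge a≢b

      d : Distance n
      d = dist ϵ E

    planted-isMetric : IsMetric d
    planted-isMetric = dist-isMetric 0≤ϵ ϵ≉0 ϵ≤1 E (singleEdge-matching a≢b)

    weight-singleEdge≤ : weight d E ≤ ϵ
    weight-singleEdge≤ = sum-atMostOne-≤ (uncurry d) 0≤ϵ (edges-unique E) (singleEdge-edges a≢b)
      (λ {e} e∈ → ≤-reflexive (≈.reflexive
        (dist-adj ϵ E {proj₁ e} {proj₂ e} (proj₂ (∈-edges⁻ E e∈)))))

    -- A completion set must contain an edge, because `a` and `b` lie in different components, and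
    -- no edge is shorter than `ϵ`.
    singleEdge-optimal : (F : Forest n) → Completes F E → IsOptimalCompletion d F E
    singleEdge-optimal F E-completes = record
      { completes = E-completes
      ; minimal   = λ M M-completes →
          +-monoˡ-≤ _ (≤-trans weight-singleEdge≤ (ϵ≤weight M M-completes))
      }
      where
      ϵ≤weight : ∀ M → Completes F M → ϵ ≤ weight d M
      ϵ≤weight M M-completes =
        let u , v , uv = crossingEdge F M (Completes.connected M-completes a b)
                           (Completes.inter E-completes (singleEdge⁺ a≢b (inj₁ (refl , refl))))
        in ≤-trans (ϵ≤dist 0≤ϵ ϵ≉0 ϵ≤1 E (λ u≡v → Adj-irrefl M u≡v uv))
                   (adj≤weight planted-isMetric M uv)

    -- Any other edge has length 1, which alone exceeds the permitted weight `p * ϵ`. The argument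
    -- by contradiction is constructive because `Joins` is decidable.
    approx⇒onlyEdge : ∀ {p} (F : Forest n) {M} → 0# ≤ p → ¬ 1# ≤ p * ϵ → Completes F E →
      IsApproxCompletion p d F M → ∀ {x y} → Adj M x y → Joins a b x y
    approx⇒onlyEdge {p} F {M} 0≤p 1≰pϵ E-completes M-approx {x} {y} xy =
      decidable-stable (joins? a b x y) λ ¬joins → 1≰pϵ (begin
        1#             ≡⟨ dist-¬adj ϵ E (λ x≡y → Adj-irrefl M x≡y xy) (¬joins ∘ singleEdge⁻ a≢b) ⟨
        d x y          ≤⟨ adj≤weight planted-isMetric M xy ⟩
        weight d M     ≤⟨ IsApproxCompletion.approx M-approx E (singleEdge-optimal F E-completes) ⟩
        p * weight d E ≤⟨ *-monoˡ-≤ 0≤p weight-singleEdge≤ ⟩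
        p * ϵ          ∎)
      where open PosetReasoning poset

  uniform : Distance n
  uniform = dist 1# noEdges

  uniform-isMetric : IsMetric (uniform {n})
  uniform-isMetric = dist-isMetric 0≤1 1≉0 ≤-refl noEdges λ _ _ _ ()

  uniform≡dist : ∀ ϵ (E : EdgeSet n) {x y} → ¬ Adj E x y → uniform x y ≡ dist ϵ E x y
  uniform≡dist ϵ E {x} {y} ¬xy with x Fin.≟ y | adj E x y
  ... | yes _ | _     = refl
  ... | no _  | true  = contradiction tt ¬xy
  ... | no _  | false = refl

  -- F has exactly two components, those of a and b.
  unasked⇒onlyEdge : ∀ {p} → 0# ≤ p → (A : Algorithm n) → Approximates p A → (F : Forest n) →
    let open Forest F using (component) in
    ∀ {a b} → component a ≢ component b →
    (∀ x → component x ≡ component a ⊎ component x ≡ component b) →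
    (∀ {x y} → (x , y) ∈ asked uniform (A F) → ¬ Joins a b x y) →
    ∀ {x y} → Adj (run uniform (A F)) x y → Joins a b x y
  unasked⇒onlyEdge 0≤p A approximates F {a} {b} a≁b cover unasked {x} {y} xy =
    approx⇒onlyEdge 0≤ϵ ϵ≉0 ϵ≤1 a≢b F 0≤p 1≰pϵ (singleEdge-completes F a≢b a≁b cover)
      (approximates (dist ϵ (singleEdge a≢b)) F (planted-isMetric 0≤ϵ ϵ≉0 ϵ≤1 a≢b))
      (subst (λ M → Adj M x y) same xy)
    where
    a≢b : a ≢ b
    a≢b = a≁b ∘ cong (Forest.component F)

    small = ∃-small 0≤p
    ϵ     = proj₁ small
    0≤ϵ   = proj₁ (proj₂ small)
    ϵ≉0   = proj₁ (proj₂ (proj₂ small))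
    ϵ≤1   = proj₁ (proj₂ (proj₂ (proj₂ small)))
    1≰pϵ  = proj₂ (proj₂ (proj₂ (proj₂ small)))

    -- The two metrics differ only on the pair of `a` and `b`, which the run in the uniform metric
    -- asks in neither orientation.
    same : run uniform (A F) ≡ run (dist ϵ (singleEdge a≢b)) (A F)
    same = run-cong (A F) λ {x} {y} xy∈ →
      uniform≡dist ϵ (singleEdge a≢b) {x} {y} (unasked xy∈ ∘ singleEdge⁻ a≢b)

-- Counting the inter-component pairs

-- Pigeonhole: mapping each pair to the position of its image in `xs` is injective, since one
-- position holds one entry. `remQuot` encodes the pairs as `Fin (m * n)`.
injective×covered⇒*≤length : ∀ {a} {A : Set a} {m n} (f : Fin m × Fin n → A) →
  (∀ {x y} → f x ≡ f y → x ≡ y) → ∀ {xs} → (∀ x → f x ∈ xs) → m ℕ.* n ℕ.≤ length xs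
injective×covered⇒*≤length {m = m} {n} f f-injective {xs} covered =
  Fin.injective⇒≤ {f = position} λ {i} {j} i≡j →
    remQuot-injective (f-injective
      (trans (lookup-index (covered _)) (trans (cong (lookup xs) i≡j) (sym (lookup-index (covered _))))))
  where
  position : Fin (m ℕ.* n) → Fin (length xs)
  position i = index (covered (remQuot n i))

  remQuot-injective : ∀ {i j} → remQuot {m} n i ≡ remQuot n j → i ≡ j
  remQuot-injective {i} {j} eq = trans (sym (Fin.combine-remQuot {m} n i))
    (trans (cong (uncurry combine) eq) (Fin.combine-remQuot {m} n j))

-- Here `H` and `K` are the component sizes and `q` is the number of queries. From `K ≤ 2 H` the
-- square is at most `9 H²`, hence at most `9 H K` and `18 (q + 1)`, which is at most `36 q` once
-- `q` is positive.
balanced-bound : ∀ {H K q} → 2 ℕ.≤ H → H ℕ.≤ K → K ℕ.≤ suc H →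
  H ℕ.* K ℕ.≤ suc q ℕ.+ suc q → (H ℕ.+ K) ℕ.^ 2 ℕ.≤ 36 ℕ.* q
balanced-bound {H} {K} {zero} 2≤H H≤K _ HK≤ =
  -- Without queries the product would be at most 2, but it is at least 4.
  contradiction (ℕ.≤-trans (ℕ.*-mono-≤ 2≤H (ℕ.≤-trans 2≤H H≤K)) HK≤) (λ { (ℕ.s≤s (ℕ.s≤s ())) })
balanced-bound {H} {K} {suc r} 2≤H H≤K K≤1+H HK≤ = begin
  (H ℕ.+ K) ℕ.^ 2
    ≤⟨ ℕ.^-monoˡ-≤ 2 (ℕ.+-monoʳ-≤ H (ℕ.≤-trans K≤1+H (ℕ.+-monoˡ-≤ H (ℕ.<⇒≤ 2≤H)))) ⟩
  (H ℕ.+ (H ℕ.+ H)) ℕ.^ 2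
    ≡⟨ solve 1 (λ x → (x :+ (x :+ x)) :^ 2 := con 9 :* (x :* x)) refl H ⟩
  9 ℕ.* (H ℕ.* H)
    ≤⟨ ℕ.*-monoʳ-≤ 9 (ℕ.≤-trans (ℕ.*-monoʳ-≤ H H≤K) HK≤) ⟩
  9 ℕ.* (2 ℕ.+ r ℕ.+ (2 ℕ.+ r))
    ≤⟨ ℕ.*-monoʳ-≤ 9 (ℕ.m≤m+n (2 ℕ.+ r ℕ.+ (2 ℕ.+ r)) (r ℕ.+ r)) ⟩
  9 ℕ.* (2 ℕ.+ r ℕ.+ (2 ℕ.+ r) ℕ.+ (r ℕ.+ r))
    ≡⟨ solve 1 (λ x → con 9 :* (con 2 :+ x :+ (con 2 :+ x) :+ (x :+ x)) := con 36 :* (con 1 :+ x)) refl r ⟩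
  36 ℕ.* suc r ∎
  where
  open ℕ.≤-Reasoning
  open +-*-Solver

module _ (h k : ℕ) where

  side : Fin (suc h ℕ.+ suc k) → Fin 2
  side x = [ const zero , const (suc zero) ]′ (splitAt (suc h) x)

  side-↑ˡ : ∀ i → side (i ↑ˡ suc k) ≡ zero
  side-↑ˡ i = cong [ const zero , const (suc zero) ]′ (Fin.splitAt-↑ˡ (suc h) i (suc k))

  side-↑ʳ : ∀ j → side (suc h ↑ʳ j) ≡ suc zero
  side-↑ʳ j = cong [ const zero , const (suc zero) ]′ (Fin.splitAt-↑ʳ (suc h) (suc k) j)

  -- Both sizes are successors, so each side has a first point to serve as the centre.
  twoStars : Forest (suc h ℕ.+ suc k)
  twoStars = starForest side
    (λ { zero → zero ↑ˡ suc k ; (suc zero) → suc h ↑ʳ zero })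
    (λ { zero → side-↑ˡ zero ; (suc zero) → side-↑ʳ zero })

  crossPair : Fin (suc h) × Fin (suc k) → Fin (suc h ℕ.+ suc k) × Fin (suc h ℕ.+ suc k)
  crossPair (i , j) = i ↑ˡ suc k , suc h ↑ʳ j

  crossPair-injective : ∀ {x y} → crossPair x ≡ crossPair y → x ≡ y
  crossPair-injective eq = cong₂ _,_
    (Fin.↑ˡ-injective (suc k) _ _ (cong proj₁ eq)) (Fin.↑ʳ-injective (suc h) _ _ (cong proj₂ eq))

-- The query lower bounds

module _ {c ℓ₁ ℓ₂} (K : OrderedField c ℓ₁ ℓ₂) where
  open OrderedField K using (Carrier; _≤_; 0#; 1#)
  open MFC K hiding (Carrier; _≈_; _≤_; _+_; _*_; 0#; 1#)
  open OrderedFieldProperties K using (≤-trans; ≤-refl; 0≤1)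

  -- Every pair across the two sides is a query or the chosen edge, up to orientation. That is
  -- `suc q` entries, counted twice for the two orientations.
  twoStars-queries : ∀ h k {p} → 0# ≤ p → (A : Algorithm (suc h ℕ.+ suc k)) → Approximates p A →
    let q = queries (uniform K) (A (twoStars h k)) in
    suc h ℕ.* suc k ℕ.≤ suc q ℕ.+ suc q
  twoStars-queries h k {p} 0≤p A approximates =
    subst (suc h ℕ.* suc k ℕ.≤_) length-pairs
      (injective×covered⇒*≤length (crossPair h k) (crossPair-injective h k) covered)
    where
    F = twoStars h k
    M = run (uniform K) (A F)

    -- The output cannot be empty, since it has to link the centres of the two stars.
    chosen : ∃[ u ] ∃[ v ] Adj M u v
    chosen = crossingEdge F M
      (Completes.connected (IsApproxCompletion.completes (approximates _ F (uniform-isMetric K)))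
        (zero ↑ˡ suc k) (suc h ↑ʳ zero))
      λ eq → Fin.0≢1+n (trans (sym (side-↑ˡ h k zero)) (trans eq (side-↑ʳ h k zero)))

    -- The chosen edge covers the one inter-component pair that may remain unasked.
    directed pairs : List (Fin (suc h ℕ.+ suc k) × Fin (suc h ℕ.+ suc k))
    directed = (proj₁ chosen , proj₁ (proj₂ chosen)) ∷ asked K (uniform K) (A F)
    pairs    = directed ++ map swap directed

    length-pairs : length pairs ≡ suc (queries (uniform K) (A F)) ℕ.+ suc (queries (uniform K) (A F))
    length-pairs = trans (length-++ directed)
      (cong₂ ℕ._+_ length-directed (trans (length-map swap directed) length-directed))
      where
      length-directed : length directed ≡ suc (queries (uniform K) (A F))
      length-directed = cong suc (length-asked K (uniform K) (A F))

    joined∈pairs : ∀ {a b x y} → (x , y) ∈ directed → Joins a b x y → (a , b) ∈ pairs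
    joined∈pairs xy∈ (inj₁ (refl , refl)) = ∈-++⁺ˡ xy∈
    joined∈pairs xy∈ (inj₂ (refl , refl)) = ∈-++⁺ʳ directed (∈-map⁺ swap xy∈)

    covered : ∀ ij → crossPair h k ij ∈ pairs
    -- A pair that is not listed was not queried, so every output edge joins it, in particular the
    -- chosen one; but that edge is listed in both orientations.
    covered (i , j) = decidable-stable (_ ∈? pairs) λ ab∉ → ab∉ (joined∈pairs (here refl)
      (unasked⇒onlyEdge K 0≤p A approximates F
        (λ eq → Fin.0≢1+n (trans (sym (side-↑ˡ h k i)) (trans eq (side-↑ʳ h k j))))
        cover (λ xy∈ → ab∉ ∘ joined∈pairs (there xy∈)) (proj₂ (proj₂ chosen))))
      where
      open DecMembership (Product.≡-dec Fin._≟_ Fin._≟_) using (_∈?_)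

      cover : ∀ x → side h k x ≡ side h k (i ↑ˡ suc k) ⊎ side h k x ≡ side h k (suc h ↑ʳ j)
      cover x with side h k x
      ... | zero     = inj₁ (sym (side-↑ˡ h k i))
      ... | suc zero = inj₂ (sym (side-↑ʳ h k j))

  -- The points are split into halves of sizes `⌊n/2⌋` and `⌈n/2⌉`; from `n = 4` on, the smaller one
  -- has the two points that `balanced-bound` requires.
  approximation-bound : ∀ n → 4 ℕ.≤ n → ∀ {p} → 1# ≤ p →
    (A : Algorithm n) → Approximates p A → WorstCase≥n²/ 36 A
  approximation-bound n@(suc (suc (suc (suc l)))) _ {p} 1≤p =
    -- The two stars live on `suc h + suc k` points, which is `n` only up to a propositional
    -- equality.
    subst (λ n → (A : Algorithm n) → Approximates p A → WorstCase≥n²/ 36 A) (ℕ.⌊n/2⌋+⌈n/2⌉≡n n)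
      λ A approximates → uniform K , twoStars h k , uniform-isMetric K ,
        -- The last bound compares `⌊(n+1)/2⌋`, which is `⌈n/2⌉`, with `⌊(n+2)/2⌋`, which is
        -- `⌊n/2⌋ + 1`.
        balanced-bound (ℕ.s≤s (ℕ.s≤s ℕ.z≤n)) (ℕ.⌊n/2⌋≤⌈n/2⌉ n) (ℕ.⌊n/2⌋-mono (ℕ.n≤1+n (suc n)))
          (twoStars-queries h k (≤-trans 0≤1 1≤p) A approximates)
    where
    h k : ℕ
    h = suc ℕ.⌊ l /2⌋
    k = suc ℕ.⌈ l /2⌉
  approximation-bound 1 (ℕ.s≤s ())
  approximation-bound 2 (ℕ.s≤s (ℕ.s≤s ()))
  approximation-bound 3 (ℕ.s≤s (ℕ.s≤s (ℕ.s≤s ())))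

theorem3p1 : ∀ {c ℓ₁ ℓ₂} (K : OrderedField c ℓ₁ ℓ₂) → let open MFC K in
    (∃[ C ] ∃[ N ] ∀ n → N ℕ.≤ n →
    (A : Algorithm n) → Solves A → WorstCase≥n²/ C A)
    ×
    (∃[ C ] ∃[ N ] ∀ n → N ℕ.≤ n →
    (p : Carrier) → 1# ≤ p →
    (A : Algorithm n) → Approximates p A → WorstCase≥n²/ C A)
theorem3p1 K =
  (36 , 4 , λ n 4≤n A solves →
    approximation-bound K n 4≤n ≤-refl A (Solves⇒Approximates K {A = A} solves)) ,
  -- The constants precede `p`: the factor influences only the choice of `ϵ`, not the count of
  -- pairs.
  (36 , 4 , λ n 4≤n p 1≤p → approximation-bound K n 4≤n 1≤p)
  where open OrderedFieldProperties K using (≤-refl)
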